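{- Let $G$ be a directed weighted multigraph with positive edge weights and let $s,t$ be two given vertices of $G$. Assume that the only operation an algorithm can perform is a query that takes a vertex already seen and asks for its next out-neighbor (in an adversarial ordering) together with the weight of the edge to that out-neighbor. Consider the algorithm that executes Dijkstra's algorithm from $s$ and stops once it closes some vertex $v$ with $\hat d(s,v)=\hat d(s,t)$ (possibly $v=t$). Then this algorithm correctly computes the $st$-distance $d(s,t)$, as the value $\hat d(s,t)$ at the time it stops. Furthermore, no correct deterministic algorithm $A$ (that is, no deterministic algorithm in this query model that outputs the $st$-distance correctly on every input) can perform fewer queries on $G$ than this algorithm does.
   Context: Graphs are directed multigraphs (self-loops and parallel edges are allowed) with edge weights $\ell:E(G)\to\mathbb{R}_{>0}$; $d(u,v)$ is the shortest-path distance from $u$ to $v$ ($+\infty$ if $v$ is not reachable from $u$). Query model: each vertex $u$ has a list of its outgoing edges in an arbitrary (adversarial) order. A query to a vertex that has been seen (the given vertices $s,t$, and vertices returned by earlier queries) returns the next edge on its out-list, i.e. the head and the weight of that edge; if the list is exhausted, the query reports this. No other access is available: in particular vertex degrees cannot be queried and incoming edges of a vertex cannot be enumerated. Each query has unit cost. Dijkstra's algorithm from $s$: it maintains for each vertex $w$ the length $\hat d(s,w)$ of the shortest $sw$-path found so far ($\hat d(s,s)=0$, and $+\infty$ if none has been found). Initially $s$ is open and all other vertices are unvisited. Repeatedly, the open vertex $u$ with smallest $\hat d(s,u)$ is selected; at this moment it is said to be closed, and, unless the algorithm stops at this point, all edges $uv$ leaving $u$ are queried and relaxed: if $v$ is unvisited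 it becomes open and $\hat d(s,v):=\hat d(s,u)+\ell(uv)$; if $v$ is open, $\hat d(s,v):=\min(\hat d(s,v),\hat d(s,u)+\ell(uv))$; if $v$ is closed nothing happens. The algorithm also halts if no open vertex remains (in which case $t$ is unreachable and $\hat d(s,t)=+\infty$). The stopping condition is tested when a vertex is closed, before its outgoing edges are queried. -}

module Defs where

open import Level using (Level; Lift; _⊔_; suc)
open import Algebra.Structures using (IsCommutativeRing)
open import Data.Bool using (if_then_else_)
open import Data.Fin using (Fin; toℕ)
import Data.Fin.Properties as Fin
open import Data.List using (List; []; _∷_; drop; filter; foldr; head; length; map; mapMaybe)
open import Data.List.Membership.Propositional using (_∈_)
open import Data.List.Relation.Unary.All using (All; lookup; _∷_)
open import Data.List.Relation.Unary.Any using (here; there)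
import Data.List.Membership.DecPropositional as DecMembership
import Data.List.Extrema as Extrema
open import Data.Maybe as Maybe using (Maybe; just; nothing)
open import Data.Nat as ℕ using (ℕ)
open import Data.Product using (∃; _×_; _,_; proj₁; proj₂; map₁)
open import Data.Sum using (inj₁; inj₂)
open import Relation.Binary.Bundles using (TotalOrder)
open import Relation.Binary.PropositionalEquality using (_≡_; _≢_)
open import Relation.Binary.Structures using (IsDecTotalOrder)
import Relation.Binary.Construct.NonStrictToStrict as NonStrictToStrict
import Relation.Binary.Construct.Add.Supremum.NonStrict as AddSupremum
open import Relation.Nullary using (¬_; Dec; does)
open import Relation.Nullary.Decidable using (¬?)
open import Relation.Nullary.Construct.Add.Supremum using (_⁺; [_]; ⊤⁺; ≡-dec)
import Algebra.Construct.NaturalChoice.Min as NaturalMin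

-- The weights are taken from an arbitrary linearly ordered field.  The real
-- numbers, with exact arithmetic and exact comparisons, are the intended
-- instance.
record OrderedField (c ℓ : Level) : Set (suc (c ⊔ ℓ)) where
  infix  8 -_
  infixl 7 _*_
  infixl 6 _+_
  infix  4 _≤_
  field
    Carrier           : Set c
    _≤_               : Carrier → Carrier → Set ℓ
    _+_ _*_           : Carrier → Carrier → Carrier
    -_                : Carrier → Carrier
    0# 1#             : Carrier
    isCommutativeRing : IsCommutativeRing _≡_ _+_ _*_ -_ 0# 1#
    0≢1               : 0# ≢ 1#
    inverse           : ∀ x → x ≢ 0# → ∃ λ y → x * y ≡ 1#
    isDecTotalOrder   : IsDecTotalOrder _≡_ _≤_
    +-mono-≤          : ∀ {x y} z → x ≤ y → x + z ≤ y + z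
    *-nonneg          : ∀ {x y} → 0# ≤ x → 0# ≤ y → 0# ≤ x * y

  open NonStrictToStrict _≡_ _≤_ public using (_<_)

module Model {c ℓ : Level} (F : OrderedField c ℓ) where

  open OrderedField F

  Distance : Set c
  Distance = Carrier ⁺

  infixl 6 _⊕_
  _⊕_ : Distance → Carrier → Distance
  [ x ] ⊕ w = [ x + w ]
  ⊤⁺    ⊕ w = ⊤⁺

  open AddSupremum _≤_ public using (_≤⁺_; ≤⁺-isTotalOrder-≡)

  distanceOrder : TotalOrder c c (c ⊔ ℓ)
  distanceOrder = record
    { isTotalOrder = ≤⁺-isTotalOrder-≡ (IsDecTotalOrder.isTotalOrder isDecTotalOrder) }

  open NaturalMin distanceOrder public using (_⊓_)

  _≟ᵈ_ : (x y : Distance) → Dec (x ≡ y)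
  _≟ᵈ_ = ≡-dec (IsDecTotalOrder._≟_ isDecTotalOrder)

  -- A graph together with the order in which the out-edges of each vertex
  -- are returned by queries.
  record Graph (n : ℕ) : Set (c ⊔ ℓ) where
    field
      out      : Fin n → List (Fin n × Carrier)
      positive : ∀ u → All (λ e → 0# < proj₂ e) (out u)

  open Graph public

  -- Walks, indexed by their length.  Since weights are positive, allowing
  -- repeated vertices does not change the shortest-path distance.
  infixr 5 _∷_
  data Walk {n} (G : Graph n) : Fin n → Fin n → Carrier → Set c where
    []  : ∀ {u} → Walk G u u 0#
    _∷_ : ∀ {u v x w d} → (v , w) ∈ out G u → Walk G v x d → Walk G u x (w + d)

  IsDistance : ∀ {n} → Graph n → Fin n → Fin n → Distance → Set (c ⊔ ℓ)
  IsDistance G u v [ d ] = Walk G u v d × (∀ {d′} → Walk G u v d′ → d ≤ d′)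
  IsDistance G u v ⊤⁺    = Lift ℓ (∀ {d} → ¬ Walk G u v d)

  -- Head and weight of the next out-edge, or nothing if the list is exhausted.
  Response : Set → Set c
  Response V = Maybe (V × Carrier)

  -- Algorithms refer to vertices by natural-number names and are not told
  -- how many vertices there are.
  Name : Set
  Name = ℕ

  data Action : Set c where
    query  : Name → Action
    output : Distance → Action

  -- The next action depends only on s, t and the responses so far (latest
  -- first); these determine the earlier queries of a deterministic algorithm.
  record Algorithm : Set c where
    field next : (s t : Name) → List (Response Name) → Action

  open Algorithm public

  -- The queries made so far and their responses, latest first.
  Transcript : ℕ → Set c
  Transcript n = List (Fin n × Response (Fin n))

  observed : ∀ {n} → Transcript n → List (Response Name)
  observed = map λ (_ , r) → Maybe.map (map₁ toℕ) r

  seen : ∀ {n} → (s t : Fin n) → Transcript n → List (Fin n)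
  seen s t h = s ∷ t ∷ mapMaybe (λ (_ , r) → Maybe.map proj₁ r) h

  timesQueried : ∀ {n} → Fin n → Transcript n → ℕ
  timesQueried v h = length (filter (λ (u , _) → u Fin.≟ v) h)

  respond : ∀ {n} → Graph n → Fin n → ℕ → Response (Fin n)
  respond G v k = head (drop k (out G v))

  -- An algorithm that queries an unseen vertex gets stuck: its transcript
  -- cannot be extended.
  data Produces (A : Algorithm) {n} (G : Graph n) (s t : Fin n) : Transcript n → Set c where
    start : Produces A G s t []
    step  : ∀ {h v} → Produces A G s t h →
            next A (toℕ s) (toℕ t) (observed h) ≡ query (toℕ v) →
            v ∈ seen s t h →
            Produces A G s t ((v , respond G v (timesQueried v h)) ∷ h)

  -- A, run on (G , s , t), halts with output d after exactly q queries.
  HaltsWith : Algorithm → ∀ {n} → Graph n → (s t : Fin n) → Distance → ℕ → Set c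
  HaltsWith A G s t d q = ∃ λ h →
    Produces A G s t h ×
    next A (toℕ s) (toℕ t) (observed h) ≡ output d ×
    length h ≡ q

  Correct : Algorithm → Set (c ⊔ ℓ)
  Correct A = ∀ {n} (G : Graph n) (s t : Fin n) →
    ∃ λ d → ∃ λ q → HaltsWith A G s t d q × IsDistance G s t d

  -- Vertices in neither list are unvisited.
  record Search : Set c where
    field
      opened closed : List Name
      d̂            : Name → Distance

  open Search public

  -- A rule choosing an open vertex with smallest d̂, i.e. a way to break ties.
  record ExtractMin : Set (c ⊔ ℓ) where
    field
      pick     : Search → Name
      pick-min : ∀ σ {v} → v ∈ opened σ →
                 pick σ ∈ opened σ × d̂ σ (pick σ) ≤⁺ d̂ σ v

  module Dijkstra (ρ : ExtractMin) where

    open ExtractMin ρ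
    open DecMembership ℕ._≟_ using (_∈?_)

    -- The vertex whose out-edges are being queried, or the final state.
    data State : Set c where
      scanning : Name → Search → State
      stopped  : Search → State

    _[_≔_] : (Name → Distance) → Name → Distance → Name → Distance
    (f [ v ≔ x ]) w = if does (w ℕ.≟ v) then x else f w

    initial : Name → Search
    initial s = record
      { opened = s ∷ [] ; closed = [] ; d̂ = (λ _ → ⊤⁺) [ s ≔ [ 0# ] ] }

    close : Name → Search → Search
    close u σ = record σ
      { opened = filter (λ v → ¬? (v ℕ.≟ u)) (opened σ) ; closed = u ∷ closed σ }

    relax : Name → Name × Carrier → Search → Search
    relax u (v , w) σ =
      if does (v ∈? closed σ) then σ
      else if does (v ∈? opened σ) then
        record σ { d̂ = d̂ σ [ v ≔ d̂ σ v ⊓ (d̂ σ u ⊕ w) ] }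
      else
        record σ { opened = v ∷ opened σ ; d̂ = d̂ σ [ v ≔ d̂ σ u ⊕ w ] }

    -- Close the next vertex and test the stopping condition.
    advance : (t : Name) → Search → State
    advance t σ with opened σ
    ... | []    = stopped σ
    ... | _ ∷ _ = if does (d̂ σ u ≟ᵈ d̂ σ t) then stopped (close u σ)
                                           else scanning u (close u σ)
      where u = pick σ

    -- Degrees being unknown, u is queried until its list is exhausted.
    update : (t : Name) → Response Name → State → State
    update t (just e) (scanning u σ) = scanning u (relax u e σ)
    update t nothing  (scanning u σ) = advance t σ
    update t _        (stopped σ)    = stopped σ

    act : (t : Name) → State → Action
    act t (scanning u σ) = query u
    act t (stopped σ)    = output (d̂ σ t)

    algorithm : Algorithm
    algorithm .next s t h = act t (foldr (update t) (advance t (initial s)) h)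

  dijkstra : ExtractMin → Algorithm
  dijkstra ρ = Dijkstra.algorithm ρ

  -- Such rules exist.
  extractMin : ExtractMin
  extractMin = record { pick = λ σ → choose (d̂ σ) (opened σ)
                      ; pick-min = λ σ → choose-min (d̂ σ) (opened σ) }
    where
    open Extrema distanceOrder

    choose : (Name → Distance) → List Name → Name
    choose f []       = 0
    choose f (x ∷ xs) = argmin f x xs

    choose-min : ∀ f xs {v} → v ∈ xs → choose f xs ∈ xs × f (choose f xs) ≤⁺ f v
    choose-min f (x ∷ xs) v∈ = mem ,
        lookup (f[argmin]≤f[⊤] {f = f} x xs ∷ f[argmin]≤f[xs] {f = f} x xs) v∈
      where
      mem : argmin f x xs ∈ x ∷ xs
      mem with argmin-sel f x xs
      ... | inj₁ eq = here eq
      ... | inj₂ m  = there m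

{-# OPTIONS --safe #-}
module Submission where

-- When Dijkstra's algorithm scans u without stopping, every walk from s to t is
-- longer than d(s,u): the first open vertex y on the walk has d̂(s,y) ≥ d(s,u), and
-- since weights are positive, equality of lengths would force y = t and then
-- d̂(s,t) = d̂(s,u).  A correct algorithm must query such a u until its list is
-- exhausted, since otherwise a short last edge u → t could be appended to the list
-- unnoticed and would shorten d(s,t).  Dijkstra's algorithm queries such vertices
-- exactly that often and no others at all, so comparing the numbers of queries
-- vertex by vertex gives optimality.

open import Defs
open import Level using (Level; _⊔_; lift)
open import Algebra.Bundles using (Ring)
import Algebra.Construct.NaturalChoice.Min as NaturalMin
import Algebra.Properties.CommutativeMonoid.Sum as Summation
import Algebra.Properties.Ring as RingProperties
open import Algebra.Structures using (IsCommutativeRing)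
open import Data.Bool using (if_then_else_; true; false)
open import Data.Fin using (Fin; toℕ; zero; suc)
import Data.Fin.Properties as Fin
open import Data.List using (List; []; _∷_; _++_; drop; foldr; head; length)
import Data.List.Membership.DecPropositional as DecMembership
open import Data.List.Membership.Propositional using (_∈_; _∉_)
open import Data.List.Membership.Propositional.Properties using (∈-++⁺ˡ; ∈-++⁺ʳ; ∈-filter⁻; ∈-filter⁺)
open import Data.List.Properties using (++-identityʳ)
open import Data.List.Relation.Unary.All as All using (All; []; _∷_)
import Data.List.Relation.Unary.All.Properties as All
open import Data.List.Relation.Unary.Any using (here; there)
open import Data.Maybe using (just; nothing)
open import Data.Nat as ℕ using (ℕ; zero; suc; z≤n; s≤s)
import Data.Nat.Properties as ℕ
open import Data.Product using (∃; _×_; _,_; proj₁; proj₂)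
open import Data.Sum as Sum using (_⊎_; inj₁; inj₂)
open import Function using (_∘_)
open import Relation.Binary.Bundles using (TotalOrder)
import Relation.Binary.Construct.Add.Supremum.NonStrict as AddSupremum
open import Relation.Binary.PropositionalEquality
open import Relation.Binary.Structures using (IsDecTotalOrder)
open import Relation.Nullary using (¬_; Dec; does; yes; no; contradiction)
open import Relation.Nullary.Construct.Add.Supremum using ([_]; ⊤⁺)
open import Relation.Nullary.Decidable using (¬?; dec-true; dec-false)

open Summation ℕ.+-0-commutativeMonoid using (sum; ∑-distrib-+; sum-replicate-zero; sum-cong-≗)

-- Reading a list by position

module _ {a} {A : Set a} where

  ∈⇒head-drop : ∀ {xs : List A} {x} → x ∈ xs →
                ∃ λ k → k ℕ.< length xs × head (drop k xs) ≡ just x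
  ∈⇒head-drop (here refl) = 0 , s≤s z≤n , refl
  ∈⇒head-drop (there x∈) with k , k< , eq ← ∈⇒head-drop x∈ = suc k , s≤s k< , eq

  head-drop⇒∈ : ∀ (xs : List A) k {x} → head (drop k xs) ≡ just x → x ∈ xs
  head-drop⇒∈ (x ∷ xs) zero    refl = here refl
  head-drop⇒∈ (x ∷ xs) (suc k) eq   = there (head-drop⇒∈ xs k eq)
  head-drop⇒∈ []       (suc k) ()

  head-drop≡nothing : ∀ (xs : List A) k → head (drop k xs) ≡ nothing → length xs ℕ.≤ k
  head-drop≡nothing []       k       eq = z≤n
  head-drop≡nothing (x ∷ xs) (suc k) eq = s≤s (head-drop≡nothing xs k eq)

  head-drop-length : ∀ (xs : List A) → head (drop (length xs) xs) ≡ nothing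
  head-drop-length []       = refl
  head-drop-length (x ∷ xs) = head-drop-length xs

  -- This is why an algorithm that has not been told that a list has ended cannot notice an edge
  -- appended to it.
  head-drop-++ : ∀ (xs ys : List A) k → head (drop k xs) ≢ nothing →
                 head (drop k (xs ++ ys)) ≡ head (drop k xs)
  head-drop-++ []       ys zero    ≢nothing = contradiction refl ≢nothing
  head-drop-++ []       ys (suc k) ≢nothing = contradiction refl ≢nothing
  head-drop-++ (x ∷ xs) ys zero    ≢nothing = refl
  head-drop-++ (x ∷ xs) ys (suc k) ≢nothing = head-drop-++ xs ys k ≢nothing

-- Sums over vertices

indicator : ∀ {n} → Fin n → Fin n → ℕ
indicator u v = if does (u Fin.≟ v) then 1 else 0

sum-indicator : ∀ {n} (u : Fin n) → sum (indicator u) ≡ 1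
sum-indicator {suc n} zero    = cong suc (sum-replicate-zero n)
sum-indicator {suc n} (suc u) = sum-indicator u

sum-mono-≤ : ∀ {n} {f g : Fin n → ℕ} → (∀ v → f v ℕ.≤ g v) → sum f ℕ.≤ sum g
sum-mono-≤ {zero}  f≤g = z≤n
sum-mono-≤ {suc n} f≤g = ℕ.+-mono-≤ (f≤g zero) (sum-mono-≤ (f≤g ∘ suc))

-- Arithmetic in ordered fields

module OrderedFieldProperties {c ℓ : Level} (F : OrderedField c ℓ) where

  open OrderedField F
  open IsCommutativeRing isCommutativeRing public
    using (+-assoc; +-comm; +-identityˡ; +-identityʳ; -‿inverseʳ; -‿inverseˡ;
           distribʳ; *-identityˡ; isRing)
  open IsDecTotalOrder isDecTotalOrder public
    using (total; antisym) renaming (refl to ≤-refl; trans to ≤-trans)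

  ring : Ring c c
  ring = record { isRing = isRing }

  open RingProperties ring using (+-cancelˡ; -1*x≈-x; -‿involutive)

  <-irrefl : ∀ {x} → ¬ x < x
  <-irrefl (_ , x≢x) = x≢x refl

  <-≤-trans : ∀ {x y z} → x < y → y ≤ z → x < z
  <-≤-trans (x≤y , x≢y) y≤z = ≤-trans x≤y y≤z , λ { refl → x≢y (antisym x≤y y≤z) }

  ≤-<-trans : ∀ {x y z} → x ≤ y → y < z → x < z
  ≤-<-trans x≤y (y≤z , y≢z) = ≤-trans x≤y y≤z , λ { refl → y≢z (antisym y≤z x≤y) }

  ≤-+ʳ : ∀ {x y} → 0# ≤ y → x ≤ x + y
  ≤-+ʳ {x} {y} 0≤y = subst₂ _≤_ (+-identityˡ x) (+-comm y x) (+-mono-≤ x 0≤y)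

  <-+ʳ : ∀ {x y} → 0# < y → x < x + y
  <-+ʳ {x} {y} (0≤y , 0≢y) =
    ≤-+ʳ 0≤y , λ eq → 0≢y (+-cancelˡ x 0# y (trans (+-identityʳ x) eq))

  -- If `1# ≤ 0#`, then `- 1#` is nonnegative, hence so is its square `1#`.
  0<1 : 0# < 1#
  0<1 with total 0# 1#
  ... | inj₁ 0≤1 = 0≤1 , 0≢1
  ... | inj₂ 1≤0 = subst (0# ≤_) -1*-1≡1 (*-nonneg 0≤-1 0≤-1) , 0≢1
    where
    0≤-1 : 0# ≤ - 1#
    0≤-1 = subst₂ _≤_ (-‿inverseʳ 1#) (+-identityˡ (- 1#)) (+-mono-≤ (- 1#) 1≤0)
    -1*-1≡1 : - 1# * - 1# ≡ 1#
    -1*-1≡1 = trans (-1*x≈-x (- 1#)) (-‿involutive 1#)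

  half : ∀ x → ∃ λ y → y + y ≡ x
  -- `1# + 1#` is invertible because `0# < 1#` and `1# ≤ 1# + 1#`.
  half x with y , 2y≡1 ← inverse (1# + 1#) (≢-sym (proj₂ (<-≤-trans 0<1 (≤-+ʳ (proj₁ 0<1))))) =
    y * x , (begin
      y * x + y * x              ≡⟨ distribʳ x y y ⟨
      (y + y) * x                ≡⟨ cong (λ z → (z + z) * x) (*-identityˡ y) ⟨
      (1# * y + 1# * y) * x      ≡⟨ cong (_* x) (distribʳ y 1# 1#) ⟨
      (1# + 1#) * y * x          ≡⟨ cong (_* x) 2y≡1 ⟩
      1# * x                     ≡⟨ *-identityˡ x ⟩
      x                          ∎)
    where open ≡-Reasoning

  -- Half of the gap `y + - x` serves as `ε`; were it at most `0#`, adding it twice to `x` would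
  -- give `y ≤ x`. It supplies the weight of the appended edge.
  between : ∀ {x y} → x < y → ∃ λ ε → 0# < ε × x + ε < y
  between {x} {y} x<y with half (y + - x)
  ... | ε , ε+ε≡y-x = ε , 0<ε , subst (x + ε <_) x+ε+ε≡y (<-+ʳ 0<ε)
    where
    x+ε+ε≡y : x + ε + ε ≡ y
    x+ε+ε≡y = begin
      x + ε + ε       ≡⟨ +-assoc x ε ε ⟩
      x + (ε + ε)     ≡⟨ cong (x +_) ε+ε≡y-x ⟩
      x + (y + - x)   ≡⟨ +-comm x (y + - x) ⟩
      y + - x + x     ≡⟨ +-assoc y (- x) x ⟩
      y + (- x + x)   ≡⟨ cong (y +_) (-‿inverseˡ x) ⟩
      y + 0#          ≡⟨ +-identityʳ y ⟩
      y               ∎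
      where open ≡-Reasoning
    ε≰0 : ¬ ε ≤ 0#
    ε≰0 ε≤0 = <-irrefl (<-≤-trans x<y (subst (_≤ x) x+ε+ε≡y
      (≤-trans (shrink (x + ε)) (shrink x))))
      where
      shrink : ∀ z → z + ε ≤ z
      shrink z = subst₂ _≤_ (+-comm ε z) (+-identityˡ z) (+-mono-≤ z ε≤0)
    0<ε : 0# < ε
    0<ε with total 0# ε
    ... | inj₁ 0≤ε = 0≤ε , λ { refl → ε≰0 ≤-refl }
    ... | inj₂ ε≤0 = contradiction ε≤0 ε≰0

-- Walks and query counts

module QueryModel {c ℓ : Level} (F : OrderedField c ℓ) where

  open OrderedField F
  open OrderedFieldProperties F
  open Model F

  positive-edge : ∀ {n} (G : Graph n) {u v w} → (v , w) ∈ out G u → 0# < w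
  positive-edge G e∈ = All.lookup (positive G _) e∈

  walk-nonneg : ∀ {n} {G : Graph n} {u v d} → Walk G u v d → 0# ≤ d
  walk-nonneg         []      = ≤-refl
  walk-nonneg {G = G} (e∈ ∷ p) = ≤-trans (proj₁ (positive-edge G e∈)) (≤-+ʳ (walk-nonneg p))

  _∷ʳ_ : ∀ {n} {G : Graph n} {u v x d w} → Walk G u v d → (x , w) ∈ out G v → Walk G u x (d + w)
  _∷ʳ_ {w = w} [] e∈ = subst (Walk _ _ _) (trans (+-identityʳ w) (sym (+-identityˡ w))) (e∈ ∷ [])
  (f∈ ∷ p) ∷ʳ e∈ = subst (Walk _ _ _) (sym (+-assoc _ _ _)) (f∈ ∷ (p ∷ʳ e∈))

  timesQueried-∷ : ∀ {n} (u v : Fin n) r (h : Transcript n) →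
                   timesQueried v ((u , r) ∷ h) ≡ indicator u v ℕ.+ timesQueried v h
  timesQueried-∷ u v r h with u Fin.≟ v
  ... | yes _ = refl
  ... | no  _ = refl

  timesQueried-self : ∀ {n} (u : Fin n) r (h : Transcript n) →
                      timesQueried u ((u , r) ∷ h) ≡ suc (timesQueried u h)
  timesQueried-self u r h with u Fin.≟ u
  ... | yes _  = refl
  ... | no u≢u = contradiction refl u≢u

  timesQueried-other : ∀ {n} {u v : Fin n} r (h : Transcript n) → u ≢ v →
                       timesQueried v ((u , r) ∷ h) ≡ timesQueried v h
  timesQueried-other {u = u} {v} r h u≢v with u Fin.≟ v
  ... | yes u≡v = contradiction u≡v u≢v
  ... | no  _   = refl

  -- Splits the cost of a run into one count per vertex, so that two runs can be compared vertex by
  -- vertex.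
  length≡sum-timesQueried : ∀ {n} (h : Transcript n) → length h ≡ sum (λ v → timesQueried v h)
  length≡sum-timesQueried {n} []            = sym (sum-replicate-zero n)
  length≡sum-timesQueried {n} ((u , r) ∷ h) = begin
    suc (length h)                                          ≡⟨ cong suc (length≡sum-timesQueried h) ⟩
    suc (sum (λ v → timesQueried v h))                      ≡⟨ cong (ℕ._+ sum (λ v → timesQueried v h)) (sum-indicator u) ⟨
    sum (indicator u) ℕ.+ sum (λ v → timesQueried v h)      ≡⟨ ∑-distrib-+ (indicator u) (λ v → timesQueried v h) ⟨
    sum (λ v → indicator u v ℕ.+ timesQueried v h)          ≡⟨ sum-cong-≗ (λ v → timesQueried-∷ u v r h) ⟨
    sum (λ v → timesQueried v ((u , r) ∷ h))                ∎
    where open ≡-Reasoning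

  queried⇒∈ : ∀ {n} {v : Fin n} (h : Transcript n) → 0 ℕ.< timesQueried v h → ∃ λ r → (v , r) ∈ h
  queried⇒∈ {v = v} ((u , r) ∷ h) 0< with u Fin.≟ v
  ... | yes refl = r , here refl
  ... | no  _    with r′ , r′∈ ← queried⇒∈ h 0< = r′ , there r′∈

  query-injective : ∀ {a b} → query a ≡ query b → a ≡ b
  query-injective refl = refl

  output≢query : ∀ {d a} → output d ≢ query a
  output≢query ()

  -- Runs of a deterministic algorithm

  module _ {A : Algorithm} {n} {G : Graph n} {s t : Fin n} where

    -- Successive queries to `v` read positions 0, 1, 2, ... of its list, so position `k` has been
    -- read once `v` has been queried more than `k` times.
    answered : ∀ {h v k} → Produces A G s t h → k ℕ.< timesQueried v h → (v , respond G v k) ∈ h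
    answered {v = v} (step {h} {u} p _ _) k< with u Fin.≟ v
    ... | no  _    = there (answered p k<)
    ... | yes refl with ℕ.m≤n⇒m<n∨m≡n (ℕ.≤-pred k<)
    ...   | inj₁ k<′  = there (answered p k<′)
    ...   | inj₂ refl = here refl

    -- The inequality is strict because the query that returns `nothing` comes on top of one query
    -- for each edge.
    exhausted⇒length< : ∀ {h v} → Produces A G s t h → (v , nothing) ∈ h →
                        length (out G v) ℕ.< timesQueried v h
    exhausted⇒length< {v = v} (step {h} {u} p _ _) (there v∈) =
      subst (length (out G v) ℕ.<_) (sym (timesQueried-∷ u v _ h))
        (ℕ.≤-trans (exhausted⇒length< p v∈) (ℕ.m≤n+m _ (indicator u v)))
    exhausted⇒length< {v = v} (step {h} {u} p _ _) (here eq) with refl ← cong proj₁ eq =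
      subst (length (out G v) ℕ.<_) (sym (timesQueried-self u _ h))
        (s≤s (head-drop≡nothing (out G v) _ (sym (cong proj₂ eq))))

    exhausted⇒answered : ∀ {h v e} → Produces A G s t h → (v , nothing) ∈ h →
                         e ∈ out G v → (v , just e) ∈ h
    exhausted⇒answered {h} {v} p v∈ e∈ with k , k< , eq ← ∈⇒head-drop e∈ =
      subst (λ r → (v , r) ∈ h) eq (answered p (ℕ.<-trans k< (exhausted⇒length< p v∈)))

    unexhausted⇒≤length : ∀ {h v} → Produces A G s t h → (v , nothing) ∉ h →
                          timesQueried v h ℕ.≤ length (out G v)
    unexhausted⇒≤length {h} {v} p v∉ = ℕ.≮⇒≥ λ len< →
      v∉ (subst (λ r → (v , r) ∈ h) (head-drop-length (out G v)) (answered p len<))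

    -- Determinism: the responses so far fix the next query, and a name fixes its vertex.
    produces-unique : ∀ {h h′} → Produces A G s t h → Produces A G s t h′ →
                      length h ≡ length h′ → h ≡ h′
    produces-unique start start eq = refl
    produces-unique (step p q _) (step p′ q′ _) eq
      with refl ← produces-unique p p′ (ℕ.suc-injective eq)
      with refl ← Fin.toℕ-injective (query-injective (trans (sym q) q′)) = refl

    earlier-query : ∀ {h k} → Produces A G s t h → k ℕ.< length h → ∃ λ h′ →
      Produces A G s t h′ × length h′ ≡ k × ∃ λ a → next A (toℕ s) (toℕ t) (observed h′) ≡ query a
    earlier-query (step p q _) k< with ℕ.m≤n⇒m<n∨m≡n (ℕ.≤-pred k<)
    ... | inj₁ k<′  = earlier-query p k<′
    ... | inj₂ refl = _ , p , refl , _ , q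

    -- A longer run would pass through a transcript of the same length as `h`, hence through `h`
    -- itself, and would there query instead of output.
    halted-first : ∀ {h h′ d} → Produces A G s t h →
      next A (toℕ s) (toℕ t) (observed h) ≡ output d → Produces A G s t h′ → length h′ ℕ.≤ length h
    halted-first p o p′ = ℕ.≮⇒≥ λ h<h′ →
      let _ , p″ , len , _ , q = earlier-query p′ h<h′ in
      output≢query (trans (sym o) (trans (cong (λ h → next A _ _ (observed h)) (produces-unique p p″ (sym len))) q))

    output-unique : ∀ {d q d′ q′} → HaltsWith A G s t d q → HaltsWith A G s t d′ q′ → d ≡ d′
    output-unique (h , p , o , _) (h′ , p′ , o′ , _)
      with refl ← produces-unique p p′ (ℕ.≤-antisym (halted-first p′ o′ p) (halted-first p o p′))
      with refl ← trans (sym o) o′ = refl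

  correct-output : ∀ {A} → Correct A → ∀ {n} (G : Graph n) {s t d q} →
                   HaltsWith A G s t d q → IsDistance G s t d
  correct-output A-correct G {s} {t} halts with d , q , halts′ , dist ← A-correct G s t
    with refl ← output-unique halts halts′ = dist

  -- The adversary: a last edge from `u` to `t`

  module _ {n} (G : Graph n) (u t : Fin n) {ε} (0<ε : 0# < ε) where

    extra : Fin n → List (Fin n × Carrier)
    extra v = if does (u Fin.≟ v) then (t , ε) ∷ [] else []

    extra-positive : ∀ v → All (λ e → 0# < proj₂ e) (extra v)
    extra-positive v with u Fin.≟ v
    ... | yes _ = 0<ε ∷ []
    ... | no  _ = []

    appendEdge : Graph n
    appendEdge = record
      { out      = λ v → out G v ++ extra v
      ; positive = λ v → All.++⁺ (positive G v) (extra-positive v)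
      }

    appended-∈ : (t , ε) ∈ out appendEdge u
    appended-∈ with u Fin.≟ u
    ... | yes _  = ∈-++⁺ʳ (out G u) (here refl)
    ... | no u≢u = contradiction refl u≢u

    appendEdge-walk : ∀ {x y d} → Walk G x y d → Walk appendEdge x y d
    appendEdge-walk []       = []
    appendEdge-walk (e∈ ∷ p) = ∈-++⁺ˡ e∈ ∷ appendEdge-walk p

    -- Lists other than that of `u` only gain an empty suffix, and the list of `u` is the same until
    -- its end is reached.
    appendEdge-respond : ∀ v k → ¬ (v , respond G v k) ≡ (u , nothing) →
                         respond appendEdge v k ≡ respond G v k
    appendEdge-respond v k ≢nothing with u Fin.≟ v
    ... | yes refl = head-drop-++ (out G u) _ k (≢nothing ∘ cong (u ,_))
    ... | no  _    = cong (head ∘ drop k) (++-identityʳ (out G v))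

    appendEdge-produces : ∀ {A s t′ h} → Produces A G s t′ h → (u , nothing) ∉ h →
                          Produces A appendEdge s t′ h
    appendEdge-produces start u∉ = start
    appendEdge-produces {A} {s} {t′} (step {h} {v} p q v∈) u∉ =
      subst (λ r → Produces A appendEdge s t′ ((v , r) ∷ h))
        (appendEdge-respond v (timesQueried v h) (u∉ ∘ here ∘ sym))
        (step (appendEdge-produces p (u∉ ∘ there)) q v∈)

  -- Otherwise the run could not tell G from the graph in which a last edge
  -- u → t makes t closer to s.
  must-exhaust : ∀ {A} → Correct A → ∀ {n} (G : Graph n) {s t u : Fin n} {x} →
                 Walk G s u x → (∀ {d} → Walk G s t d → x < d) →
                 ∀ {h d} → Produces A G s t h → next A (toℕ s) (toℕ t) (observed h) ≡ output d →
                 length (out G u) ℕ.< timesQueried u h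
  must-exhaust {A} A-correct G {s} {t} {u} {x} s⇝u x<t {h} {d} p o =
    -- With at most as many queries to `u` as it has out-edges, the end of its list cannot have been
    -- reported.
    ℕ.≰⇒> λ queried≤ → absurd o (ℕ.≤⇒≯ queried≤ ∘ exhausted⇒length< p)
    where
    module _ (u∉ : (u , nothing) ∉ h) {ε} (0<ε : 0# < ε) where

      closer : Walk (appendEdge G u t 0<ε) s t (x + ε)
      closer = appendEdge-walk G u t 0<ε s⇝u ∷ʳ appended-∈ G u t 0<ε

      unchanged : ∀ {d} → next A (toℕ s) (toℕ t) (observed h) ≡ output d →
                  IsDistance (appendEdge G u t 0<ε) s t d
      unchanged o = correct-output A-correct _ (h , appendEdge-produces G u t 0<ε p u∉ , o , refl)

    absurd : ∀ {d} → next A (toℕ s) (toℕ t) (observed h) ≡ output d → ¬ (u , nothing) ∉ h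
    -- A finite output `y` is the length of a walk in `G`, so `x < y` and there is room for `ε`. The
    -- same output on the extended graph exceeds the new walk of length `x + ε`.
    absurd {[ y ]} o u∉ with s⇝t , _ ← correct-output A-correct G (h , p , o , refl)
      with ε , 0<ε , x+ε<y ← between (x<t s⇝t) =
      <-irrefl (<-≤-trans x+ε<y (proj₂ (unchanged u∉ 0<ε o) (closer u∉ 0<ε)))
    -- Any positive weight refutes an infinite output, so `1#` is taken.
    absurd {⊤⁺} o u∉ with lift no-walk ← unchanged u∉ 0<1 o = no-walk (closer u∉ 0<1)

-- The invariant of Dijkstra's algorithm

module DijkstraProperties {c ℓ : Level} (F : OrderedField c ℓ)
  (ρ : Model.ExtractMin F) {n} (G : Model.Graph F n) (s t : Fin n) where

  open OrderedField F
  open OrderedFieldProperties F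
  open Model F
  open QueryModel F
  open ExtractMin ρ
  open Dijkstra ρ
  open NaturalMin distanceOrder using (x⊓y≤x; x⊓y≤y; ⊓-sel)
  open DecMembership ℕ._≟_ using (_∈?_)
  open AddSupremum _≤_ using ([_]; _≤⊤⁺)
  module ≤⁺ = TotalOrder distanceOrder

  finite : ∀ {p x} → p ≤⁺ [ x ] → ∃ λ y → p ≡ [ y ]
  finite [ _ ] = _ , refl

  ⊕-monoˡ : ∀ {p q w} → p ≤⁺ q → p ⊕ w ≤⁺ q ⊕ w
  ⊕-monoˡ [ x≤y ]   = [ +-mono-≤ _ x≤y ]
  ⊕-monoˡ (_ ≤⊤⁺)   = _ ≤⊤⁺

  set-same : ∀ f a p → (f [ a ≔ p ]) a ≡ p
  set-same f a p rewrite dec-true (a ℕ.≟ a) refl = refl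

  set-other : ∀ f {a b} p → b ≢ a → (f [ a ≔ p ]) b ≡ f b
  set-other f {a} {b} p b≢a rewrite dec-false (b ℕ.≟ a) b≢a = refl

  seen-∷ : ∀ {v} q (h : Transcript n) → v ∈ seen s t h → v ∈ seen s t (q ∷ h)
  seen-∷ (_ , just _)  h (here eq)          = here eq
  seen-∷ (_ , just _)  h (there (here eq))  = there (here eq)
  seen-∷ (_ , just _)  h (there (there v∈)) = there (there (there v∈))
  seen-∷ (_ , nothing) h v∈                 = v∈

  -- The state of a vertex closed without stopping. Together with `sound`, `minimal` makes the value
  -- the exact distance; `before-t` is what forces every correct algorithm to exhaust the vertex.
  record Settled (v : Fin n) (p : Distance) : Set (c ⊔ ℓ) where
    constructor settled-at
    field
      {dist}   : Carrier
      p≡       : p ≡ [ dist ]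
      minimal  : ∀ {d} → Walk G s v d → dist ≤ d
      before-t : ∀ {d} → Walk G s t d → dist < d

  -- Closed vertices are all settled, so the invariant is not carried over to the closing that stops
  -- the search. `source` is an inequality because lowering values preserves it directly.
  record Invariant (h : Transcript n) (σ : Search) : Set (c ⊔ ℓ) where
    field
      source      : d̂ σ (toℕ s) ≤⁺ [ 0# ]
      sound       : ∀ v {x} → d̂ σ (toℕ v) ≡ [ x ] → Walk G s v x
      visited     : ∀ (v : Fin n) {x} → d̂ σ (toℕ v) ≤⁺ [ x ] → toℕ v ∈ opened σ ⊎ toℕ v ∈ closed σ
      open-seen   : ∀ {a} → a ∈ opened σ → ∃ λ v → a ≡ toℕ v × v ∈ seen s t h
      open-finite : ∀ {a} → a ∈ opened σ → ∃ λ x → d̂ σ a ≡ [ x ]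
      disjoint    : ∀ {a} → a ∈ opened σ → a ∉ closed σ
      settled     : ∀ v → toℕ v ∈ closed σ → Settled v (d̂ σ (toℕ v))
      queried     : ∀ {v r} → (v , r) ∈ h → toℕ v ∈ closed σ
      relaxed     : ∀ {v y w} → (v , just (y , w)) ∈ h → d̂ σ (toℕ y) ≤⁺ d̂ σ (toℕ v) ⊕ w

    t-not-closed : toℕ t ∉ closed σ
    t-not-closed t∈ with settled-at d̂t≡ _ x<t ← settled t t∈ = <-irrefl (x<t (sound t d̂t≡))

  open Invariant

  -- The first open vertex on a walk

  Exhausted : Transcript n → Search → Set c
  Exhausted h σ = ∀ v → toℕ v ∈ closed σ → (v , nothing) ∈ h

  module Frontier {h σ} (inv : Invariant h σ) (prod : Produces (dijkstra ρ) G s t h)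
                  (exhausted : Exhausted h σ) where

    -- While the walk stays in closed vertices, their relaxed edges carry the bound `x` forward. It
    -- stops at the first open vertex `y`; if the walk continues from there, the rest has positive
    -- length, which gives `z ≢ x + e`.
    frontier : ∀ {a v e x} → Walk G a v e → d̂ σ (toℕ a) ≤⁺ [ x ] → toℕ v ∈ closed σ ⊎
      ∃ λ y → ∃ λ z → toℕ y ∈ opened σ × d̂ σ (toℕ y) ≤⁺ [ z ] × z ≤ x + e × (z ≢ x + e ⊎ y ≡ v)
    frontier {a} {x = x} p d̂a≤ with visited inv a d̂a≤
    frontier {a} {x = x} [] d̂a≤ | inj₂ a∈ = inj₁ a∈
    frontier {a} {x = x} [] d̂a≤ | inj₁ a∈ = inj₂ (a , x , a∈ , d̂a≤ , ≤-+ʳ ≤-refl , inj₂ refl)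
    frontier {a} {x = x} (e∈ ∷ p) d̂a≤ | inj₁ a∈ = inj₂ (a , x , a∈ , d̂a≤ , proj₁ x<x+e , inj₁ (proj₂ x<x+e))
      where
      x<x+e = <-+ʳ (<-≤-trans (positive-edge G e∈) (≤-+ʳ (walk-nonneg p)))
    frontier {a} {x = x} (_∷_ {w = w} {d} e∈ p) d̂a≤ | inj₂ a∈
      with frontier p (≤⁺.trans (relaxed inv (exhausted⇒answered prod (exhausted a a∈) e∈)) (⊕-monoˡ d̂a≤))
    ... | inj₁ v∈ = inj₁ v∈
    ... | inj₂ (y , z , y∈ , d̂y≤ , z≤ , z≢) rewrite +-assoc x w d = inj₂ (y , z , y∈ , d̂y≤ , z≤ , z≢)

    min-open≤walk : ∀ {x v d} → (∀ {a} → a ∈ opened σ → [ x ] ≤⁺ d̂ σ a) → Walk G s v d →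
      toℕ v ∈ closed σ ⊎ x ≤ d × (x ≢ d ⊎ toℕ v ∈ opened σ × d̂ σ (toℕ v) ≤⁺ [ d ])
    min-open≤walk {x} {v} {d} x-min p with frontier p (source inv)
    ... | inj₁ v∈ = inj₁ v∈
    ... | inj₂ (y , z , y∈ , d̂y≤ , z≤ , z≢) rewrite +-identityˡ d
      with ≤⁺.trans (x-min y∈) d̂y≤
    ...   | [ x≤z ] = inj₂ (≤-trans x≤z z≤ , x≢d z≢)
      where
      x≢d : z ≢ d ⊎ y ≡ v → x ≢ d ⊎ toℕ v ∈ opened σ × d̂ σ (toℕ v) ≤⁺ [ d ]
      x≢d (inj₁ z≢d)  = inj₁ (proj₂ (≤-<-trans x≤z (z≤ , z≢d)))
      x≢d (inj₂ refl) = inj₂ (y∈ , ≤⁺.trans d̂y≤ [ z≤ ])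

    module _ {x} (x-min : ∀ {a} → a ∈ opened σ → [ x ] ≤⁺ d̂ σ a) where

      min-open-minimal : ∀ {v d} → toℕ v ∉ closed σ → Walk G s v d → x ≤ d
      min-open-minimal v∉ p with min-open≤walk x-min p
      ... | inj₁ v∈        = contradiction v∈ v∉
      ... | inj₂ (x≤d , _) = x≤d

      -- A walk of length exactly `x` would leave `t` open with value at most `x`, hence equal to
      -- the least open value, which the failed stopping test excludes.
      min-open-before-t : [ x ] ≢ d̂ σ (toℕ t) → ∀ {d} → Walk G s t d → x < d
      min-open-before-t x≢d̂t p with min-open≤walk x-min p
      ... | inj₁ t∈                        = contradiction t∈ (t-not-closed inv)
      ... | inj₂ (x≤d , inj₁ x≢d)          = x≤d , x≢d
      ... | inj₂ (x≤d , inj₂ (t∈ , d̂t≤d)) =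
        x≤d , λ { refl → x≢d̂t (≤⁺.antisym (x-min t∈) d̂t≤d) }

      -- Covers stopping at a vertex other than `t`: all that matters is that `t` shares the least
      -- open value.
      min-open-at-t : d̂ σ (toℕ t) ≡ [ x ] → IsDistance G s t (d̂ σ (toℕ t))
      min-open-at-t eq rewrite eq = sound inv t eq , min-open-minimal (t-not-closed inv)

    none-open⇒unreachable : opened σ ≡ [] → ∀ {d} → ¬ Walk G s t d
    none-open⇒unreachable none p with frontier p (source inv)
    ... | inj₁ t∈ = t-not-closed inv t∈
    ... | inj₂ (_ , _ , y∈ , _) with () ← subst (_ ∈_) none y∈

    none-open : opened σ ≡ [] → IsDistance G s t (d̂ σ (toℕ t))
    none-open none with d̂ σ (toℕ t) in eq
    ... | [ _ ] = contradiction (sound inv t eq) (none-open⇒unreachable none)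
    ... | ⊤⁺    = lift (none-open⇒unreachable none)

  -- Preservation of the invariant

  ∈-close⁻ : ∀ a σ {b} → b ∈ opened (close a σ) → b ∈ opened σ × b ≢ a
  ∈-close⁻ a σ = ∈-filter⁻ (λ v → ¬? (v ℕ.≟ a)) {xs = opened σ}

  close-invariant : ∀ {h σ u} → Invariant h σ → toℕ u ∈ opened σ → Settled u (d̂ σ (toℕ u)) →
                    Invariant h (close (toℕ u) σ)
  close-invariant {σ = σ} {u} inv u∈ u-settled = record
    { source      = source inv
    ; sound       = sound inv
    ; visited     = λ v d̂v≤ → visited′ v (visited inv v d̂v≤)
    ; open-seen   = open-seen inv ∘ proj₁ ∘ ∈-close⁻ (toℕ u) σ
    ; open-finite = open-finite inv ∘ proj₁ ∘ ∈-close⁻ (toℕ u) σ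
    ; disjoint    = λ { b∈ (here b≡u) → proj₂ (∈-close⁻ (toℕ u) σ b∈) b≡u
                      ; b∈ (there b∈closed) → disjoint inv (proj₁ (∈-close⁻ (toℕ u) σ b∈)) b∈closed }
    ; settled     = λ { v (here v≡u) → subst (λ v → Settled v (d̂ σ (toℕ v))) (sym (Fin.toℕ-injective v≡u)) u-settled
                      ; v (there v∈) → settled inv v v∈ }
    ; queried     = there ∘ queried inv
    ; relaxed     = relaxed inv
    }
    where
    visited′ : ∀ (v : Fin n) → toℕ v ∈ opened σ ⊎ toℕ v ∈ closed σ →
               toℕ v ∈ opened (close (toℕ u) σ) ⊎ toℕ v ∈ toℕ u ∷ closed σ
    visited′ v (inj₂ v∈) = inj₂ (there v∈)
    visited′ v (inj₁ v∈) with toℕ v ℕ.≟ toℕ u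
    ... | yes v≡u = inj₂ (here v≡u)
    ... | no  v≢u = inj₁ (∈-filter⁺ (λ v → ¬? (v ℕ.≟ toℕ u)) v∈ v≢u)

  closed-relax : ∀ a e σ → closed (relax a e σ) ≡ closed σ
  closed-relax a (b , w) σ with does (b ∈? closed σ) | does (b ∈? opened σ)
  ... | true  | _     = refl
  ... | false | true  = refl
  ... | false | false = refl

  -- Common description of the two updating branches of `relax`, for an open and for an unvisited
  -- head, so that the invariant is checked once for both.
  record Lowered (a : Name) (p : Distance) (σ σ′ : Search) : Set (c ⊔ ℓ) where
    field
      closed≡  : closed σ′ ≡ closed σ
      a∉closed : a ∉ closed σ
      a∈opened : a ∈ opened σ′
      opened-⊇ : ∀ {b} → b ∈ opened σ → b ∈ opened σ′
      opened-⊆ : ∀ {b} → b ∈ opened σ′ → b ∈ opened σ ⊎ b ≡ a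
      others   : ∀ {b} → b ≢ a → d̂ σ′ b ≡ d̂ σ b
      bound    : d̂ σ′ a ≤⁺ p
      lowered  : d̂ σ′ a ≤⁺ d̂ σ a
      choice   : d̂ σ′ a ≡ d̂ σ a ⊎ d̂ σ′ a ≡ p

  relax-lowers : ∀ {h σ u y w} → Invariant h σ → toℕ y ∉ closed σ →
                 Lowered (toℕ y) (d̂ σ u ⊕ w) σ (relax u (toℕ y , w) σ)
  relax-lowers {σ = σ} {u} {y} {w} inv y∉ with toℕ y ∈? closed σ
  ... | yes y∈ = contradiction y∈ y∉
  ... | no _ with toℕ y ∈? opened σ
  ...   | yes y∈ = record
    { closed≡ = refl ; a∉closed = y∉ ; a∈opened = y∈ ; opened-⊇ = λ b∈ → b∈ ; opened-⊆ = inj₁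
    ; others = set-other (d̂ σ) _
    ; bound  = subst (_≤⁺ p) (sym same) (x⊓y≤y q p)
    ; lowered = subst (_≤⁺ q) (sym same) (x⊓y≤x q p)
    ; choice = Sum.map (trans same) (trans same) (⊓-sel q p)
    }
    where
    p = d̂ σ u ⊕ w
    q = d̂ σ (toℕ y)
    same = set-same (d̂ σ) (toℕ y) (q ⊓ p)
  ...   | no y∉open = record
    { closed≡ = refl ; a∉closed = y∉ ; a∈opened = here refl ; opened-⊇ = there
    ; opened-⊆ = λ { (here eq) → inj₂ eq ; (there b∈) → inj₁ b∈ }
    ; others = set-other (d̂ σ) _
    ; bound  = ≤⁺.reflexive same
    ; lowered = unvisited
    ; choice = inj₂ same
    }
    where
    -- A vertex neither open nor closed has value `⊤⁺`, so overwriting its value can only lower it.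
    unvisited : ∀ {p} → p ≤⁺ d̂ σ (toℕ y)
    unvisited with d̂ σ (toℕ y) in eq
    ... | ⊤⁺    = _ ≤⊤⁺
    ... | [ x ] = contradiction (visited inv y (≤⁺.reflexive eq)) λ { (inj₁ y∈) → y∉open y∈ ; (inj₂ y∈) → y∉ y∈ }
    same = set-same (d̂ σ) (toℕ y) (d̂ σ u ⊕ w)

  lowered-invariant : ∀ {h σ σ′ u y w} → Invariant h σ → toℕ u ∈ closed σ → (y , w) ∈ out G u →
    Lowered (toℕ y) (d̂ σ (toℕ u) ⊕ w) σ σ′ → Invariant ((u , just (y , w)) ∷ h) σ′
  lowered-invariant {h} {σ} {σ′} {u} {y} {w} inv u∈ e∈ low = record
    { source      = ≤⁺.trans (decreasing _) (source inv)
    ; sound       = sound′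
    ; visited     = visited′
    ; open-seen   = open-seen′
    ; open-finite = open-finite′
    ; disjoint    = λ a∈ a∈closed → disjoint′ (opened-⊆ a∈) (subst (_ ∈_) closed≡ a∈closed)
    ; settled     = λ v v∈ → let v∈′ = subst (_ ∈_) closed≡ v∈ in
                             subst (Settled v) (sym (unchanged v∈′)) (settled inv v v∈′)
    ; queried     = λ v∈ → subst (_ ∈_) (sym closed≡) (queried′ v∈)
    ; relaxed     = relaxed′
    }
    where
    open Lowered low

    unchanged : ∀ {a} → a ∈ closed σ → d̂ σ′ a ≡ d̂ σ a
    unchanged a∈ = others λ { refl → a∉closed a∈ }

    decreasing : ∀ a → d̂ σ′ a ≤⁺ d̂ σ a
    decreasing a with a ℕ.≟ toℕ y
    ... | yes refl = lowered
    ... | no a≢y   = ≤⁺.reflexive (others a≢y)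

    bound-finite : ∃ λ x → d̂ σ (toℕ u) ⊕ w ≡ [ x + w ] × Walk G s u x
    bound-finite with settled-at {x} d̂u≡ _ _ ← settled inv u u∈ = x , cong (_⊕ w) d̂u≡ , sound inv u d̂u≡

    sound′ : ∀ v {x} → d̂ σ′ (toℕ v) ≡ [ x ] → Walk G s v x
    sound′ v eq with v Fin.≟ y
    ... | no v≢y   = sound inv v (trans (sym (others (v≢y ∘ Fin.toℕ-injective))) eq)
    ... | yes refl with choice
    ...   | inj₁ same = sound inv v (trans (sym same) eq)
    ...   | inj₂ new with x , d̂u⊕w≡ , p ← bound-finite
                     with refl ← trans (sym (trans new d̂u⊕w≡)) eq = p ∷ʳ e∈

    visited′ : ∀ (v : Fin n) {x} → d̂ σ′ (toℕ v) ≤⁺ [ x ] → toℕ v ∈ opened σ′ ⊎ toℕ v ∈ closed σ′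
    visited′ v d̂v≤ with v Fin.≟ y
    ... | yes refl = inj₁ a∈opened
    ... | no v≢y   = Sum.map opened-⊇ (subst (_ ∈_) (sym closed≡))
      (visited inv v (subst (_≤⁺ _) (others (v≢y ∘ Fin.toℕ-injective)) d̂v≤))

    open-seen′ : ∀ {a} → a ∈ opened σ′ → ∃ λ v → a ≡ toℕ v × v ∈ seen s t ((u , just (y , w)) ∷ h)
    open-seen′ a∈ with opened-⊆ a∈
    ... | inj₂ a≡y = y , a≡y , there (there (here refl))
    ... | inj₁ a∈σ with v , a≡v , v∈ ← open-seen inv a∈σ = v , a≡v , seen-∷ (u , just (y , w)) h v∈

    open-finite′ : ∀ {a} → a ∈ opened σ′ → ∃ λ x → d̂ σ′ a ≡ [ x ]
    open-finite′ a∈ with opened-⊆ a∈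
    ... | inj₁ a∈σ with x , d̂a≡ ← open-finite inv a∈σ =
      finite (subst (_ ≤⁺_) d̂a≡ (decreasing _))
    open-finite′ a∈ | inj₂ refl with _ , d̂u⊕w≡ , _ ← bound-finite =
      finite (subst (_ ≤⁺_) d̂u⊕w≡ bound)

    disjoint′ : ∀ {a} → a ∈ opened σ ⊎ a ≡ toℕ y → a ∉ closed σ
    disjoint′ (inj₁ a∈)   = disjoint inv a∈
    disjoint′ (inj₂ refl) = a∉closed

    queried′ : ∀ {v r} → (v , r) ∈ (u , just (y , w)) ∷ h → toℕ v ∈ closed σ
    queried′ (here refl) = u∈
    queried′ (there v∈)  = queried inv v∈

    relaxed′ : ∀ {v z w′} → (v , just (z , w′)) ∈ (u , just (y , w)) ∷ h →
               d̂ σ′ (toℕ z) ≤⁺ d̂ σ′ (toℕ v) ⊕ w′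
    relaxed′ (here refl) rewrite unchanged u∈ = bound
    -- The tail of an earlier edge is closed and keeps its value, while the value at the head does
    -- not increase.
    relaxed′ (there v∈)  rewrite unchanged (queried inv v∈) = ≤⁺.trans (decreasing _) (relaxed inv v∈)

  -- An edge into a closed vertex is relaxed without any update because closed
  -- vertices carry their exact distance.
  closed-head-invariant : ∀ {h σ u y w} → Invariant h σ → toℕ u ∈ closed σ → (y , w) ∈ out G u →
    toℕ y ∈ closed σ → Invariant ((u , just (y , w)) ∷ h) σ
  closed-head-invariant {h} {σ} {u} {y} {w} inv u∈ e∈ y∈ = record
    { Invariant inv
    ; open-seen = λ a∈ → let v , a≡v , v∈ = open-seen inv a∈ in v , a≡v , seen-∷ (u , just (y , w)) h v∈
    ; queried   = λ { (here refl) → u∈ ; (there v∈) → queried inv v∈ }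
    ; relaxed   = λ { (here refl) → exact ; (there v∈) → relaxed inv v∈ }
    }
    where
    exact : d̂ σ (toℕ y) ≤⁺ d̂ σ (toℕ u) ⊕ w
    exact with settled-at d̂u≡ _ _ ← settled inv u u∈ | settled-at d̂y≡ y-min _ ← settled inv y y∈ =
      subst₂ _≤⁺_ (sym d̂y≡) (sym (cong (_⊕ w) d̂u≡)) [ y-min (sound inv u d̂u≡ ∷ʳ e∈) ]

  relax-invariant : ∀ {h σ u y w} → Invariant h σ → toℕ u ∈ closed σ → (y , w) ∈ out G u →
    Invariant ((u , just (y , w)) ∷ h) (relax (toℕ u) (toℕ y , w) σ)
  relax-invariant {h} {σ} {u} {y} {w} inv u∈ e∈ = by-cases (toℕ y ∈? closed σ)
    where
    by-cases : Dec (toℕ y ∈ closed σ) → Invariant ((u , just (y , w)) ∷ h) (relax (toℕ u) (toℕ y , w) σ)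
    by-cases (no y∉)  = lowered-invariant inv u∈ e∈ (relax-lowers inv y∉)
    by-cases (yes y∈) with toℕ y ∈? closed σ
    ... | yes _  = closed-head-invariant inv u∈ e∈ y∈
    ... | no y∉  = contradiction y∈ y∉

  exhausted-invariant : ∀ {h σ u} → Invariant h σ → toℕ u ∈ closed σ → Invariant ((u , nothing) ∷ h) σ
  exhausted-invariant inv u∈ = record
    { Invariant inv
    ; queried = λ { (here refl) → u∈ ; (there v∈) → queried inv v∈ }
    ; relaxed = λ { (there v∈) → relaxed inv v∈ }
    }

  initial-invariant : Invariant [] (initial (toℕ s))
  initial-invariant = record
    { source      = ≤⁺.reflexive (set-same _ (toℕ s) _)
    ; sound       = sound₀
    ; visited     = visited₀
    ; open-seen   = λ { (here refl) → s , refl , here refl }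
    ; open-finite = λ { (here refl) → 0# , set-same _ (toℕ s) _ }
    ; disjoint    = λ _ ()
    ; settled     = λ _ ()
    ; queried     = λ ()
    ; relaxed     = λ ()
    }
    where
    sound₀ : ∀ v {x} → d̂ (initial (toℕ s)) (toℕ v) ≡ [ x ] → Walk G s v x
    sound₀ v eq with v Fin.≟ s
    ... | yes refl with refl ← trans (sym (set-same _ (toℕ s) _)) eq = []
    ... | no v≢s with () ← trans (sym (set-other (λ _ → ⊤⁺) [ 0# ] (v≢s ∘ Fin.toℕ-injective))) eq

    visited₀ : ∀ (v : Fin n) {x} → d̂ (initial (toℕ s)) (toℕ v) ≤⁺ [ x ] → toℕ v ∈ toℕ s ∷ [] ⊎ toℕ v ∈ []
    visited₀ v {x} d̂v≤ with v Fin.≟ s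
    ... | yes refl = inj₁ (here refl)
    ... | no v≢s with () ← subst (_≤⁺ [ x ]) (set-other (λ _ → ⊤⁺) [ 0# ] (v≢s ∘ Fin.toℕ-injective)) d̂v≤

  -- Necessary vertices and phases of the run

  -- No correct algorithm can output before exhausting such a vertex.
  Necessary : Fin n → Set (c ⊔ ℓ)
  Necessary v = ∃ λ x → Walk G s v x × (∀ {d} → Walk G s t d → x < d)

  queried-necessary : ∀ {h σ v r} → Invariant h σ → (v , r) ∈ h → Necessary v
  queried-necessary inv v∈ with settled-at {x} d̂v≡ _ x<t ← settled inv _ (queried inv v∈) =
    x , sound inv _ d̂v≡ , x<t

  -- During a scan, `u` is the only closed vertex not yet exhausted. After stopping, necessity is
  -- claimed for queried vertices only, since the vertex closed last is never queried.
  data Phase (h : Transcript n) : State → Set (c ⊔ ℓ) where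
    scanning : ∀ {a σ} u → a ≡ toℕ u → Invariant h σ → u ∈ seen s t h → toℕ u ∈ closed σ →
               (u , nothing) ∉ h → (∀ v → toℕ v ∈ closed σ → v ≢ u → (v , nothing) ∈ h) →
               Phase h (scanning a σ)
    stopped  : ∀ {σ} → IsDistance G s t (d̂ σ (toℕ t)) → (∀ {v r} → (v , r) ∈ h → Necessary v) →
               Phase h (stopped σ)

  advance-phase : ∀ {h σ} → Invariant h σ → Produces (dijkstra ρ) G s t h → Exhausted h σ →
                  Phase h (advance (toℕ t) σ)
  advance-phase {h} {σ} inv prod exhausted with opened σ in eq
  ... | []    = stopped (none-open eq) (queried-necessary inv)
    where open Frontier inv prod exhausted
  ... | a ∷ _ = proceed
    where
    open Frontier inv prod exhausted

    pick∈ : pick σ ∈ opened σ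
    pick∈ = proj₁ (pick-min σ (subst (a ∈_) (sym eq) (here refl)))

    x-min : ∀ {x} → d̂ σ (pick σ) ≡ [ x ] → ∀ {b} → b ∈ opened σ → [ x ] ≤⁺ d̂ σ b
    x-min d̂≡ {b} b∈ = subst (_≤⁺ d̂ σ b) d̂≡ (proj₂ (pick-min σ b∈))

    scan : ∀ {b} u → b ≡ toℕ u → u ∈ seen s t h → b ∈ opened σ → Settled u (d̂ σ b) →
           Phase h (scanning b (close b σ))
    scan u refl u∈seen u∈ u-settled =
      scanning u refl (close-invariant inv u∈ u-settled) u∈seen (here refl)
        (disjoint inv u∈ ∘ queried inv)
        λ { v (here v≡u) v≢u → contradiction (Fin.toℕ-injective v≡u) v≢u
          ; v (there v∈) _   → exhausted v v∈ }

    proceed : Phase h (if does (d̂ σ (pick σ) ≟ᵈ d̂ σ (toℕ t)) then stopped (close (pick σ) σ)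
                                                           else scanning (pick σ) (close (pick σ) σ))
    proceed with d̂ σ (pick σ) ≟ᵈ d̂ σ (toℕ t) | open-finite inv pick∈ | open-seen inv pick∈
    -- The invariant of `σ` before the closing suffices here, because `close` leaves `d̂` unchanged.
    ... | yes d̂≡ | x , d̂pick≡ | _ =
      stopped (min-open-at-t (x-min d̂pick≡) (trans (sym d̂≡) d̂pick≡)) (queried-necessary inv)
    ... | no d̂≢  | x , d̂pick≡ | u , pick≡u , u∈seen =
      scan u pick≡u u∈seen pick∈ (settled-at d̂pick≡
        (min-open-minimal (x-min d̂pick≡) (subst (_∉ closed σ) pick≡u (disjoint inv pick∈)))
        (min-open-before-t (x-min d̂pick≡) (d̂≢ ∘ trans d̂pick≡)))

  -- Termination

  state : Transcript n → State
  state h = foldr (update (toℕ t)) (advance (toℕ t) (initial (toℕ s))) (observed h)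

  -- One query per out-edge, plus one that reports the end of the list.
  Bounded : Transcript n → Set
  Bounded h = ∀ v → timesQueried v h ℕ.≤ suc (length (out G v))

  totalQueries : ℕ
  totalQueries = sum (λ v → suc (length (out G v)))

  bounded⇒≤ : ∀ h → Bounded h → length h ℕ.≤ totalQueries
  bounded⇒≤ h bounded = subst (ℕ._≤ totalQueries) (sym (length≡sum-timesQueried h)) (sum-mono-≤ bounded)

  bounded-∷ : ∀ {h u} → Produces (dijkstra ρ) G s t h → (u , nothing) ∉ h → Bounded h →
              ∀ r → Bounded ((u , r) ∷ h)
  bounded-∷ {h} {u} prod u∉ bounded r v with u Fin.≟ v
  ... | yes refl = s≤s (unexhausted⇒≤length prod u∉)
  ... | no  _    = bounded v

  Optimal : Set (c ⊔ ℓ)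
  Optimal = ∃ λ h → ∃ λ d →
    Produces (dijkstra ρ) G s t h × act (toℕ t) (state h) ≡ output d × IsDistance G s t d ×
    Bounded h × (∀ {v r} → (v , r) ∈ h → Necessary v)

  -- Recursion on the number of queries still allowed: each query adds one to the transcript, whose
  -- length `Bounded` caps by `totalQueries`.
  run : ∀ fuel {h st} → totalQueries ℕ.≤ fuel ℕ.+ length h → Produces (dijkstra ρ) G s t h →
        Bounded h → state h ≡ st → Phase h st → Optimal
  run fuel {h} enough prod bounded state≡ (stopped dist necessary) =
    h , _ , prod , cong (act (toℕ t)) state≡ , dist , bounded , necessary
  run fuel {h} enough prod bounded state≡ (scanning {σ = σ} u refl inv u∈seen u∈ u∉ others) =
    continue fuel enough
    where
    k = timesQueried u h
    r = respond G u k

    prod′ : Produces (dijkstra ρ) G s t ((u , r) ∷ h)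
    prod′ = step prod (cong (act (toℕ t)) state≡) u∈seen

    bounded′ : Bounded ((u , r) ∷ h)
    bounded′ = bounded-∷ prod u∉ bounded r

    -- The response is generalised to `r′` so that matching on it lets `update` compute.
    phase′ : ∀ r′ → r ≡ r′ → Phase ((u , r′) ∷ h) (state ((u , r′) ∷ h))
    phase′ (just (y , w)) eq rewrite state≡ =
      scanning u refl (relax-invariant inv u∈ (head-drop⇒∈ (out G u) k eq)) (seen-∷ (u , just (y , w)) h u∈seen)
        (subst (toℕ u ∈_) (sym closed≡) u∈) (λ { (there u∈h) → u∉ u∈h })
        λ v v∈ v≢u → there (others v (subst (toℕ v ∈_) closed≡ v∈) v≢u)
      where
      closed≡ = closed-relax (toℕ u) (toℕ y , w) σ
    phase′ nothing eq rewrite state≡ =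
      advance-phase (exhausted-invariant inv u∈) (subst (λ r → Produces (dijkstra ρ) G s t ((u , r) ∷ h)) eq prod′)
        exhausted′
      where
      exhausted′ : Exhausted ((u , nothing) ∷ h) σ
      exhausted′ v v∈ with v Fin.≟ u
      ... | yes refl = here refl
      ... | no v≢u   = there (others v v∈ v≢u)

    continue : ∀ fuel → totalQueries ℕ.≤ fuel ℕ.+ length h → Optimal
    -- Without fuel `h` already has `totalQueries` entries, so the pending query would exceed the
    -- bound.
    continue zero       enough = contradiction (ℕ.≤-trans (bounded⇒≤ ((u , r) ∷ h) bounded′) enough) (ℕ.<-irrefl refl)
    continue (suc fuel) enough =
      run fuel (subst (totalQueries ℕ.≤_) (sym (ℕ.+-suc fuel (length h))) enough) prod′ bounded′ refl (phase′ r refl)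

  optimal : Optimal
  optimal = run totalQueries (ℕ.m≤m+n totalQueries 0) start (λ _ → z≤n) refl
    (advance-phase initial-invariant start λ _ ())

-- Correctness and optimality

open import Data.Nat using (_≤_)

theorem2 : ∀ {c ℓ} (F : OrderedField c ℓ) → let open Model F in
    (ρ : ExtractMin) → ∀ {n} (G : Graph n) (s t : Fin n) →
    ∃ λ d → ∃ λ q →
    HaltsWith (dijkstra ρ) G s t d q ×
    IsDistance G s t d ×
    (∀ A → Correct A → ∀ {d′ q′} → HaltsWith A G s t d′ q′ → q ≤ q′)
theorem2 F ρ G s t with optimal
  where open DijkstraProperties F ρ G s t
... | h , d , prod , out≡ , dist , bounded , necessary =
  d , length h , (h , prod , out≡ , refl) , dist , minimal
  where
  open Model F
  open QueryModel F

  minimal : ∀ A → Correct A → ∀ {d′ q′} → HaltsWith A G s t d′ q′ → length h ≤ q′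
  minimal A A-correct (h′ , prod′ , out′≡ , refl) =
    subst₂ _≤_ (sym (length≡sum-timesQueried h)) (sym (length≡sum-timesQueried h′)) (sum-mono-≤ fewer)
    where
    fewer : ∀ v → timesQueried v h ≤ timesQueried v h′
    fewer v with timesQueried v h in eq
    ... | zero  = z≤n
    ... | suc k with _ , v∈ ← queried⇒∈ h (subst (0 ℕ.<_) (sym eq) (s≤s z≤n))
                with x , s⇝v , x<t ← necessary v∈ =
      -- Dijkstra's algorithm queries `v` at most once more than its out-degree, and `A` has to
      -- query it at least that often.
      ℕ.≤-trans (subst (_≤ _) eq (bounded v)) (must-exhaust A-correct G s⇝v x<t prod′ out′≡)
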